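{- Let $\mathcal{I}=\langle\mathbf{C},\mathbb{X},O,tr\rangle$ be a context interactive system with $\|\mathbf{C}\|$ countable and $tr$ of countable degree. For $i\in|\mathbf{C}|$ and $p\in X_i$ put $\alpha_{\mathcal{I}}(p)=\{(c,o,q)\mid c\in\mathbf{C}[i,j]\text{ for some }j,\ (c_{\mathbb{X}}(p),o,q)\in tr\}$. Then $\langle\mathbb{X},\alpha_{\mathcal{I}}\rangle$ is an $\mathbf{H}$-coalgebra, i.e. $\alpha_{\mathcal{I}}:\mathbb{X}\to\mathbf{H}(\mathbb{X})$ is a $\Gamma(\mathbf{C})$-homomorphism.
   Context: Composition is in diagrammatic order: $d;e$ means first $d$, then $e$. $|\mathbf{C}|$ and $\|\mathbf{C}\|$ are the sets of objects and arrows of a small category $\mathbf{C}$. A $\Gamma(\mathbf{C})$-algebra $\mathbb{X}$ is a family of sets $X=(X_i)_{i\in|\mathbf{C}|}$ with a function $c_{\mathbb{X}}:X_i\to X_j$ for every $c\in\mathbf{C}[i,j]$ such that $(id_i)_{\mathbb{X}}=id_{X_i}$ and $(d;e)_{\mathbb{X}}(x)=e_{\mathbb{X}}(d_{\mathbb{X}}(x))$ (i.e. a functor $\mathbf{C}\to\mathbf{Set}$); homomorphisms are natural transformations; the category is $\mathbf{Alg}_{\Gamma(\mathbf{C})}$. $\int X=\sum_iX_i$ is the disjoint union. A context interactive system is a quadruple $\langle\mathbf{C},\mathbb{X},O,tr\rangle$ with $\mathbf{C}$ a small category, $\mathbb{X}$ a $\Gamma(\mathbf{C})$-algebra, $O$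 a set (observations) and $tr\subseteq\int X\times O\times\int X$. Countable degree means that each state has at most countably many outgoing transitions. $\mathbf{G}(X)_i$ is the set of (at most) countable subsets of $\sum_{j\in|\mathbf{C}|}\mathbf{C}[i,j]\times O\times\int X$. The endofunctor $\mathbf{H}$ of $\mathbf{Alg}_{\Gamma(\mathbf{C})}$ maps $\mathbb{X}$ to the algebra with carrier $(\mathbf{G}(X)_i)_i$ and operations, for $d\in\mathbf{C}[i,k]$ and $A\in\mathbf{G}(X)_i$, $d_{\mathbf{H}(\mathbb{X})}(A)=\{(c_2,o,x)\mid (c_1,o,x)\in A,\ c_1=d;c_2\}$; on arrows $\mathbf{H}(h)(A)=\{(c,o,h(x))\mid(c,o,x)\in A\}$. An $\mathbf{H}$-coalgebra is a pair $\langle\mathbb{X},\alpha\rangle$ with $\alpha:\mathbb{X}\to\mathbf{H}(\mathbb{X})$ a homomorphism. -}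

module Defs where

open import Level using (Level; _⊔_; suc)
open import Data.Nat as ℕ using (ℕ)
import Data.Nat.Properties as ℕ
open import Data.Product using (Σ; Σ-syntax; ∃-syntax; _×_; _,_; proj₁; proj₂)
open import Data.Product.Relation.Binary.Pointwise.NonDependent using (_×ₛ_)
open import Function.Base using (id; _∘_)
open import Function.Bundles using (Surjection)
open import Relation.Binary.Bundles using (Setoid)
open import Relation.Binary.Definitions using (_Respects_; tri<; tri≈; tri>)
import Relation.Binary.Construct.On as On
open import Relation.Binary.PropositionalEquality as ≡ using (_≡_)
open import Relation.Nullary using (contradiction)
open import Relation.Unary using (Pred; _≐_)

open Setoid using (Carrier; refl; sym; trans)

-- The sets of the mathematics are setoids here, since subsets have to be
-- compared extensionally.  The exceptions are the sets of objects and arrows of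
-- a category, which serve as indices and carry _≡_.

infix 4 _[_≈_]

_[_≈_] : ∀ {a e} (A : Setoid a e) → Carrier A → Carrier A → Set e
A [ x ≈ y ] = Setoid._≈_ A x y

module _ {i a e} (I : Set i) (A : I → Setoid a e) where

  data _≈∑_ : Σ I (Carrier ∘ A) → Σ I (Carrier ∘ A) → Set (i ⊔ a ⊔ e) where
    in-fibre : ∀ {k x y} → A k [ x ≈ y ] → (k , x) ≈∑ (k , y)

  ∑ : Setoid (i ⊔ a) (i ⊔ a ⊔ e)
  ∑ = record
    { Carrier       = Σ I (Carrier ∘ A)
    ; _≈_           = _≈∑_
    ; isEquivalence = record
      { refl  = λ { {k , _} → in-fibre (refl (A k)) }
      ; sym   = λ { {k , _} (in-fibre p) → in-fibre (sym (A k) p) }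
      ; trans = λ { {k , _} (in-fibre p) (in-fibre q) → in-fibre (trans (A k) p q) }
      }
    }

record Subset {a e} (A : Setoid a e) p : Set (a ⊔ e ⊔ suc p) where
  field
    member : Pred (Carrier A) p
    resp   : member Respects Setoid._≈_ A

open Subset public

elements : ∀ {a e p} {A : Setoid a e} → Subset A p → Setoid (a ⊔ p) e
elements {A = A} S = On.setoid {B = Σ (Carrier A) (member S)} A proj₁

-- At most countable: the image of some set D of natural numbers.  D need not
-- be decidable; classically this agrees with being finite or countably
-- infinite, and constructively it is stable under both subsets and images.
Countable : ∀ {a e} → Setoid a e → Set (suc a ⊔ e)
Countable {a} A = Σ[ D ∈ Subset (≡.setoid ℕ) a ] Surjection (elements D) A

module _ {a e} {A : Setoid a e} where

  code : Countable A → Carrier A → ℕ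
  code (_ , f) = proj₁ ∘ Surjection.to⁻ f

  code-injective : (c : Countable A) → ∀ {x y} → code c x ≡ code c y → A [ x ≈ y ]
  code-injective (_ , f) {x} {y} eq =
    trans A (sym A (Surjection.to∘to⁻ f x))
      (trans A (Surjection.cong f eq) (Surjection.to∘to⁻ f y))

  countable : (f : Carrier A → ℕ) → (∀ {x y} → f x ≡ f y → A [ x ≈ y ]) → Countable A
  countable f inj =
      record { member = λ n → ∃[ x ] f x ≡ n ; resp = λ { ≡.refl m → m } }
    , record
      { to         = λ (_ , x , _) → x
      ; cong       = λ { {_ , _ , p} {_ , _ , q} eq →
                         inj (≡.trans p (≡.trans eq (≡.sym q))) }
      ; surjective = λ y → (f y , y , ≡.refl) ,
                       λ { {_ , _ , p} eq → inj (≡.trans p eq) }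
      }

pair : ℕ → ℕ → ℕ
pair m n = (m ℕ.+ n) ℕ.* (m ℕ.+ n) ℕ.+ m

private
  pair-< : ∀ m n m′ n′ → m ℕ.+ n ℕ.< m′ ℕ.+ n′ → pair m n ℕ.< pair m′ n′
  pair-< m n m′ n′ s<s′ = begin-strict
    s ℕ.* s ℕ.+ m     ≤⟨ ℕ.+-monoʳ-≤ (s ℕ.* s) (ℕ.m≤m+n m n) ⟩
    s ℕ.* s ℕ.+ s     ≡⟨ ℕ.+-comm (s ℕ.* s) s ⟩
    ℕ.suc s ℕ.* s     <⟨ ℕ.*-monoʳ-< (ℕ.suc s) (ℕ.n<1+n s) ⟩
    ℕ.suc s ℕ.* ℕ.suc s ≤⟨ ℕ.*-mono-≤ s<s′ s<s′ ⟩
    s′ ℕ.* s′         ≤⟨ ℕ.m≤m+n (s′ ℕ.* s′) m′ ⟩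
    s′ ℕ.* s′ ℕ.+ m′  ∎
    where
    open ℕ.≤-Reasoning
    s  = m ℕ.+ n
    s′ = m′ ℕ.+ n′

pair-injective : ∀ {m n m′ n′} → pair m n ≡ pair m′ n′ → m ≡ m′ × n ≡ n′
pair-injective {m} {n} {m′} {n′} eq with ℕ.<-cmp (m ℕ.+ n) (m′ ℕ.+ n′)
... | tri< lt _ _ = contradiction eq (ℕ.<⇒≢ (pair-< m n m′ n′ lt))
... | tri> _ _ gt = contradiction (≡.sym eq) (ℕ.<⇒≢ (pair-< m′ n′ m n gt))
... | tri≈ _ s≡s′ _ = m≡m′ , ℕ.+-cancelˡ-≡ m n n′ (≡.trans s≡s′ (≡.cong (ℕ._+ n′) (≡.sym m≡m′)))
  where
  m≡m′ : m ≡ m′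
  m≡m′ = ℕ.+-cancelˡ-≡ ((m ℕ.+ n) ℕ.* (m ℕ.+ n)) m m′
           (≡.trans eq (≡.cong (λ s → s ℕ.* s ℕ.+ m′) (≡.sym s≡s′)))

-- _⨾_ is composition in diagrammatic order.
record SmallCategory ℓ : Set (suc ℓ) where
  infixr 9 _⨾_
  field
    Obj   : Set ℓ
    Hom   : Obj → Obj → Set ℓ
    idn   : ∀ i → Hom i i
    _⨾_   : ∀ {i j k} → Hom i j → Hom j k → Hom i k
    idˡ   : ∀ {i j} (d : Hom i j) → idn i ⨾ d ≡ d
    idʳ   : ∀ {i j} (d : Hom i j) → d ⨾ idn j ≡ d
    assoc : ∀ {i j k l} (d : Hom i j) (e : Hom j k) (f : Hom k l) →
            (d ⨾ e) ⨾ f ≡ d ⨾ (e ⨾ f)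

  Arrows : Setoid ℓ ℓ
  Arrows = ≡.setoid (Σ[ (i , j) ∈ Obj × Obj ] Hom i j)

module _ {ℓ} (C : SmallCategory ℓ) where
  open SmallCategory C

  record Algebra c e : Set (ℓ ⊔ suc (c ⊔ e)) where
    field
      sort     : Obj → Setoid c e
      op       : ∀ {i j} → Hom i j → Carrier (sort i) → Carrier (sort j)
      op-cong  : ∀ {i j} (d : Hom i j) {x x′ : Carrier (sort i)} →
                 sort i [ x ≈ x′ ] → sort j [ op d x ≈ op d x′ ]
      op-id    : ∀ {i} (x : Carrier (sort i)) → sort i [ op (idn i) x ≈ x ]
      op-⨾     : ∀ {i j k} (d : Hom i j) (e : Hom j k) (x : Carrier (sort i)) →
                 sort k [ op (d ⨾ e) x ≈ op e (op d x) ]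

    ∫ : Setoid (ℓ ⊔ c) (ℓ ⊔ c ⊔ e)
    ∫ = ∑ Obj sort

module _ {ℓ} {C : SmallCategory ℓ} where
  open SmallCategory C
  open Algebra

  record IsHomomorphism {c e c′ e′} (X : Algebra C c e) (Y : Algebra C c′ e′)
                        (h : ∀ i → Carrier (sort X i) → Carrier (sort Y i)) :
                        Set (ℓ ⊔ c ⊔ e ⊔ e′) where
    field
      cong    : ∀ {i} {x x′ : Carrier (sort X i)} → sort X i [ x ≈ x′ ] → sort Y i [ h i x ≈ h i x′ ]
      natural : ∀ {i j} (d : Hom i j) (x : Carrier (sort X i)) →
                sort Y j [ h j (op X d x) ≈ op Y d (h i x) ]

  record Homomorphism {c e c′ e′} (X : Algebra C c e) (Y : Algebra C c′ e′) :
                      Set (ℓ ⊔ c ⊔ e ⊔ c′ ⊔ e′) where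
    field
      map              : ∀ i → Carrier (sort X i) → Carrier (sort Y i)
      isHomomorphism   : IsHomomorphism X Y map
    open IsHomomorphism isHomomorphism public

  idₕ : ∀ {c e} {X : Algebra C c e} → Homomorphism X X
  idₕ {X = X} = record
    { map            = λ _ → id
    ; isHomomorphism = record { cong = id ; natural = λ {_} {j} _ _ → refl (sort X j) }
    }

  infixr 9 _⨾ₕ_
  _⨾ₕ_ : ∀ {c e c′ e′ c″ e″} {X : Algebra C c e} {Y : Algebra C c′ e′} {Z : Algebra C c″ e″} →
         Homomorphism X Y → Homomorphism Y Z → Homomorphism X Z
  _⨾ₕ_ {Z = Z} g h = record
    { map            = λ i → H.map i ∘ G.map i
    ; isHomomorphism = record
      { cong    = H.cong ∘ G.cong
      ; natural = λ {i} {j} d x → trans (sort Z j) (H.cong (G.natural d x)) (H.natural d (G.map i x))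
      }
    }
    where
    module G = Homomorphism g
    module H = Homomorphism h

record ContextInteractiveSystem ℓ c e : Set (suc (ℓ ⊔ c ⊔ e)) where
  field
    C  : SmallCategory ℓ
    X  : Algebra C c e
    O  : Setoid ℓ ℓ
  open Algebra X
  field
    tr : Subset (∫ ×ₛ (O ×ₛ ∫)) (ℓ ⊔ c ⊔ e)

  outgoing : Carrier ∫ → Subset (O ×ₛ ∫) (ℓ ⊔ c ⊔ e)
  outgoing p = record
    { member = λ t → member tr (p , t)
    ; resp   = λ eq → resp tr (refl ∫ , eq)
    }

  CountableDegree : Set (suc (ℓ ⊔ c ⊔ e))
  CountableDegree = ∀ p → Countable (elements (outgoing p))

module _ {ℓ} (C : SmallCategory ℓ) (O : Setoid ℓ ℓ) where
  open SmallCategory C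
  open Algebra

  Triples : ∀ {c e} (X : Algebra C c e) → Obj → Setoid (ℓ ⊔ c) (ℓ ⊔ c ⊔ e)
  Triples X i = ∑ Obj (λ j → ≡.setoid (Hom i j) ×ₛ (O ×ₛ ∫ X))

  G : ∀ {c e} (X : Algebra C c e) → Obj → Setoid (suc (ℓ ⊔ c ⊔ e)) (ℓ ⊔ c ⊔ e)
  G {c} {e} X i = record
    { Carrier       = Σ[ A ∈ Subset (Triples X i) (ℓ ⊔ c ⊔ e) ] Countable (elements A)
    ; _≈_           = λ (A , _) (B , _) → member A ≐ member B
    ; isEquivalence = record
      { refl  = id , id
      ; sym   = λ (p , q) → q , p
      ; trans = λ (p , q) (p′ , q′) → p′ ∘ p , q ∘ q′
      }
    }

  module _ {c e} (X : Algebra C c e) where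

    precompose : ∀ {i k} → Hom i k →
                 Subset (Triples X i) (ℓ ⊔ c ⊔ e) → Subset (Triples X k) (ℓ ⊔ c ⊔ e)
    precompose {i} d A = record
      { member = λ (j , c₂ , o , x) →
          ∃[ c₁ ] member A (j , c₁ , o , x) × c₁ ≡ d ⨾ c₂
      ; resp   = λ { (in-fibre (≡.refl , q)) (c₁ , m , r) →
          c₁ , resp A (in-fibre (≡.refl , q)) m , r }
      }

    module _ (‖C‖-countable : Countable Arrows) where

      precompose-countable : ∀ {i k} (d : Hom i k) A → Countable (elements A) →
                             Countable (elements (precompose d A))
      precompose-countable {i} {k} d A A-countable =
        countable f (λ {s} {t} → f-injective {s} {t})
        where
        f : Carrier (elements (precompose d A)) → ℕ
        f ((j , c₂ , o , x) , c₁ , m , _) =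
          pair (code ‖C‖-countable ((k , j) , c₂)) (code A-countable ((j , c₁ , o , x) , m))

        combine : ∀ {j j′ c₁ c₁′ c₂ c₂′ t t′} →
                  Arrows [ ((k , j) , c₂) ≈ ((k , j′) , c₂′) ] →
                  Triples X i [ (j , c₁ , t) ≈ (j′ , c₁′ , t′) ] →
                  Triples X k [ (j , c₂ , t) ≈ (j′ , c₂′ , t′) ]
        combine ≡.refl (in-fibre (_ , q)) = in-fibre (≡.refl , q)

        f-injective : ∀ {s t} → f s ≡ f t → elements (precompose d A) [ s ≈ t ]
        f-injective {s} {t} eq with p , q ← pair-injective
            {m = code ‖C‖-countable (_ , proj₁ (proj₂ (proj₁ s)))}
            {m′ = code ‖C‖-countable (_ , proj₁ (proj₂ (proj₁ t)))} eq =
          combine (code-injective ‖C‖-countable p) (code-injective A-countable q)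

  module _ (‖C‖-countable : Countable Arrows) where

    -- An endofunctor up to universe levels: the predicative powerset raises them.
    -- Countability of the arrows is what makes precompose preserve countability.
    H : ∀ {c e} → Algebra C c e → Algebra C (suc (ℓ ⊔ c ⊔ e)) (ℓ ⊔ c ⊔ e)
    H X = record
      { sort    = G X
      ; op      = λ d (A , A-countable) →
          precompose X d A , precompose-countable X ‖C‖-countable d A A-countable
      ; op-cong = λ d (A⊆B , B⊆A) →
            (λ (c₁ , m , r) → c₁ , A⊆B m , r)
          , (λ (c₁ , m , r) → c₁ , B⊆A m , r)
      ; op-id   = λ (A , _) →
            (λ (c₁ , m , r) →
              resp A (in-fibre (≡.trans r (idˡ _) , refl (O ×ₛ ∫ X))) m)
          , (λ { {_ , c₂ , _} m → c₂ , m , ≡.sym (idˡ c₂) })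
      ; op-⨾    = λ d e (A , _) →
            (λ { {_ , c₂ , _} (c₁ , m , r) →
              e ⨾ c₂ , (c₁ , m , ≡.trans r (assoc d e c₂)) , ≡.refl })
          , (λ { {_ , c₂ , _} (c₁ , (c₀ , m , r) , ≡.refl) →
              c₀ , m , ≡.trans r (≡.sym (assoc d e c₂)) })
      }

    module _ {c e} {X Y : Algebra C c e} (h : Homomorphism X Y) where
      private module h = Homomorphism h

      mapTriple : ∀ {i} → Carrier (Triples X i) → Carrier (Triples Y i)
      mapTriple (j , c , o , k , x) = j , c , o , k , h.map k x

      mapTriple-cong : ∀ {i s t} → Triples X i [ s ≈ t ] → Triples Y i [ mapTriple s ≈ mapTriple t ]
      mapTriple-cong (in-fibre (p , q , in-fibre r)) = in-fibre (p , q , in-fibre (h.cong r))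

      image : ∀ {i} → Subset (Triples X i) (ℓ ⊔ c ⊔ e) → Subset (Triples Y i) (ℓ ⊔ c ⊔ e)
      image {i} A = record
        { member = λ t → ∃[ s ] member A s × Triples Y i [ mapTriple s ≈ t ]
        ; resp   = λ t≈t′ (s , m , p) → s , m , trans (Triples Y i) p t≈t′
        }

      image-countable : ∀ {i} (A : Subset (Triples X i) (ℓ ⊔ c ⊔ e)) →
                        Countable (elements A) → Countable (elements (image A))
      image-countable {i} A A-countable = countable
        (λ (_ , s , m , _) → code A-countable (s , m))
        (λ { {_ , _ , _ , p} {_ , _ , _ , q} eq →
          trans (Triples Y i) (sym (Triples Y i) p)
            (trans (Triples Y i) (mapTriple-cong (code-injective A-countable eq)) q) })

      H-map : Homomorphism (H X) (H Y)
      H-map = record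
        { map            = λ i (A , A-countable) → image A , image-countable A A-countable
        ; isHomomorphism = record
          { cong    = λ (A⊆B , B⊆A) → (λ (s , m , p) → s , A⊆B m , p)
                                    , (λ (s , m , p) → s , B⊆A m , p)
          ; natural = λ d (A , _) →
                (λ { (_ , (c₁ , m , r) , in-fibre (≡.refl , q)) →
                  c₁ , (_ , m , in-fibre (≡.refl , q)) , r })
              , (λ { {_ , c₂ , _} (c₁ , (_ , m , in-fibre (≡.refl , q)) , r) →
                  (_ , c₂ , _) , (c₁ , m , r) , in-fibre (≡.refl , q) })
          }
        }

    H-map-id : ∀ {c e} {X : Algebra C c e} {i} (A : Carrier (G X i)) →
               G X i [ Homomorphism.map (H-map (idₕ {X = X})) i A ≈ A ]
    H-map-id {X = X} {i} (A , _) =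
      (λ (_ , m , p) → resp A p m) , (λ m → _ , m , refl (Triples X i))

    H-map-⨾ : ∀ {c e} {X Y Z : Algebra C c e} (g : Homomorphism X Y) (h : Homomorphism Y Z) {i}
              (A : Carrier (G X i)) →
              G Z i [ Homomorphism.map (H-map (g ⨾ₕ h)) i A
                    ≈ Homomorphism.map (H-map h) i (Homomorphism.map (H-map g) i A) ]
    H-map-⨾ {X = X} {Y} {Z} g h {i} (A , _) =
        (λ (s , m , p) → mapTriple g s , (s , m , refl (Triples Y i)) , p)
      , (λ (_ , (s , m , p) , q) → s , m , trans (Triples Z i) (mapTriple-cong h p) q)

    IsCoalgebra : ∀ {c e} (X : Algebra C c e) → (∀ i → Carrier (sort X i) → Carrier (G X i)) →
                  Set (ℓ ⊔ c ⊔ e)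
    IsCoalgebra X α = IsHomomorphism X (H X) α

module _ {ℓ c e} (𝓘 : ContextInteractiveSystem ℓ c e) where
  open ContextInteractiveSystem 𝓘
  open SmallCategory C
  open Algebra X

  α : ∀ i → Carrier (sort i) → Subset (Triples C O X i) (ℓ ⊔ c ⊔ e)
  α i p = record
    { member = λ (j , c , o , q) → member tr ((j , op c p) , o , q)
    ; resp   = λ { (in-fibre (≡.refl , t≈t′)) → resp tr (refl ∫ , t≈t′) }
    }

{-# OPTIONS --safe #-}
module Submission where

open import Defs
open import Data.Nat using (ℕ)
open import Data.Product using (Σ-syntax; _,_)
open import Data.Product.Relation.Binary.Pointwise.NonDependent using (_×ₛ_)
open import Relation.Binary.Bundles using (Setoid)
open import Relation.Binary.PropositionalEquality as ≡ using (_≡_)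

open Setoid using (Carrier; refl; sym)

-- A transition c , o , q of p is determined by the arrow c together with the
-- transition o , q of c(p), so pairing their codes enumerates α(p).  Naturality
-- is functoriality of X: the states (d ⨾ c)(p) and c(d(p)) agree and tr
-- respects equality.

module _ {ℓ c e} (𝓘 : ContextInteractiveSystem ℓ c e) where
  open ContextInteractiveSystem 𝓘
  open SmallCategory C
  open Algebra X

  -- Equations between states hold only up to the equality of their sort, so transitions have to be
  -- transported along it.
  tr-source : ∀ {i} {x y : Carrier (sort i)} {t : Carrier (O ×ₛ ∫)} → sort i [ x ≈ y ] →
              member tr ((i , x) , t) → member tr ((i , y) , t)
  tr-source x≈y = resp tr (in-fibre x≈y , refl (O ×ₛ ∫))

  module _ (‖C‖-countable : Countable Arrows) (degree : CountableDegree) where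

    α-countable : ∀ i (p : Carrier (sort i)) → Countable (elements (α 𝓘 i p))
    α-countable i p = countable f (λ {s} {t} → f-injective {s} {t})
      where
      arrowCode : ∀ {j} → Hom i j → ℕ
      arrowCode d = code ‖C‖-countable (_ , d)

      transitionCode : ∀ {j} (d : Hom i j) → Carrier (elements (outgoing (j , op d p))) → ℕ
      transitionCode d = code (degree (_ , op d p))

      f : Carrier (elements (α 𝓘 i p)) → ℕ
      f ((_ , d , t) , m) = pair (arrowCode d) (transitionCode d (t , m))

      -- Each state `op d p` has its own enumeration, so transition codes are comparable only once
      -- the arrows are identified; matching on that equality first puts both codes in one
      -- enumeration.
      combine : ∀ {j j′} {d : Hom i j} {d′ : Hom i j′} {t t′ m m′} →
                Arrows [ ((i , j) , d) ≈ ((i , j′) , d′) ] →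
                transitionCode d (t , m) ≡ transitionCode d′ (t′ , m′) →
                Triples C O X i [ (j , d , t) ≈ (j′ , d′ , t′) ]
      combine ≡.refl eq = in-fibre (≡.refl , code-injective (degree _) eq)

      f-injective : ∀ {s t} → f s ≡ f t → elements (α 𝓘 i p) [ s ≈ t ]
      f-injective {(_ , d , _) , _} {(_ , d′ , _) , _} eq
        with r , s ← pair-injective {m = arrowCode d} {m′ = arrowCode d′} eq =
        combine (code-injective ‖C‖-countable r) s

    -- Equality in `G` compares only the underlying subsets, so each law amounts to two inclusions
    -- and the enumerations need not agree.
    α-isCoalgebra : IsCoalgebra C O ‖C‖-countable X (λ i p → α 𝓘 i p , α-countable i p)
    α-isCoalgebra = record
      { cong    = λ {i} x≈y →
            (λ { {_ , d , _} → tr-source (op-cong d x≈y) })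
          , (λ { {_ , d , _} → tr-source (op-cong d (sym (sort i) x≈y)) })
      ; natural = λ d x →
            -- The operation of `H` at `d` forces the witness: `d′` must be what remains of it after
            -- `d`.
            (λ { {j , d′ , _} m → d ⨾ d′ , tr-source (sym (sort j) (op-⨾ d d′ x)) m , ≡.refl })
          , (λ { {_ , d′ , _} (_ , m , ≡.refl) → tr-source (op-⨾ d d′ x) m })
      }

theorem6p3 : ∀ {ℓ c e} (𝓘 : ContextInteractiveSystem ℓ c e) →
    let open ContextInteractiveSystem 𝓘 in
    (‖C‖-countable : Countable (SmallCategory.Arrows C)) → CountableDegree →
    Σ[ α-countable ∈ (∀ i (p : Setoid.Carrier (Algebra.sort X i)) → Countable (elements (α 𝓘 i p))) ]
    IsCoalgebra C O ‖C‖-countable X (λ i p → α 𝓘 i p , α-countable i p)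
theorem6p3 𝓘 ‖C‖-countable degree =
  α-countable 𝓘 ‖C‖-countable degree , α-isCoalgebra 𝓘 ‖C‖-countable degree
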